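{- Let $A\in\mathcal{V}$ and let $\theta$ be a congruence of $A$ with $\theta\subseteq Rad(A)$ such that $\theta$ has $CBLP$. If $A/\theta$ is $B$-normal, then $A$ is $B$-normal.
   Context: $\mathcal{V}$ is a congruence modular, semidegenerate variety (no nontrivial algebra has a one-element subalgebra) of finite signature. For $B\in\mathcal{V}$: $Con(B)$ is its congruence lattice with bounds $\Delta_B,\nabla_B$, $[\cdot,\cdot]$ the Freese–McKenzie commutator, $K(B)$ the compact congruences. A congruence $\phi\neq\nabla_B$ is prime if $[\alpha,\beta]\subseteq\phi$ implies $\alpha\subseteq\phi$ or $\beta\subseteq\phi$; $\rho(\theta)$ is the intersection of primes containing $\theta$; $Rad(B)$ is the intersection of all maximal congruences of $B$. $B(Con(B))$ is the Boolean algebra of complemented elements of $Con(B)$. When $K(B)$ is closed under the commutator, the reticulation $L(B)=K(B)/{\equiv}$ ($\alpha\equiv\beta$ iff $\rho(\alpha)=\rho(\beta)$) is a bounded distributive lattice with canonical map $\lambda_B$, mapping $B(Con(B))$ injectively into $B(L(B))$; the reticulation preserves the Boolean center if this map is onto $B(L(B))$. Standing assumption: for every $B\in\mathcal{V}$, $K(B)$ is closed under the commutator and the reticulation of $B$ preserves the Boolean center. A congruence $\theta$ of $A$ has $CBLP$ if for every $\beta\in B(Con(A/\theta))$ there is $\alpha\in B(Con(A))$ with $(\alpha\vee\theta)/\theta=\beta$. An algebra $B\in\mathcal{V}$ is $B$-normal if for all $\chi,\varepsilon\in Con(B)$ with $\chi\vee\varepsilon=\nabla_B$ there exist $\alpha,\beta\in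 B(Con(B))$ with $\chi\vee\alpha=\varepsilon\vee\beta=\nabla_B$ and $[\alpha,\beta]=\Delta_B$. -}

module Defs where

open import Axiom.ExcludedMiddle using (ExcludedMiddle)
open import Data.Fin using (Fin)
open import Data.List using (List; []; _∷_; _++_; concat; tabulate)
open import Data.List.Relation.Unary.Any using (Any; here)
open import Data.List.Relation.Unary.Any.Properties using (++⁺ˡ; ++⁺ʳ; concat⁺; tabulate⁺)
open import Data.Nat using (ℕ)
open import Data.Product using (Σ; ∃; _×_; _,_; proj₁; proj₂; swap)
open import Data.Sum using (_⊎_; inj₁; inj₂; [_,_]′)
open import Data.Unit.Polymorphic using (⊤; tt)
open import Function using (_⇔_; mk⇔; id; _∘_)
open import Level using (Level; _⊔_; Lift; lift) renaming (suc to lsuc)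
open import Relation.Binary using (Rel; IsEquivalence; Poset)
open import Relation.Binary.Lattice using (BoundedLattice)
open import Relation.Nullary using (¬_; yes; no)
open import Relation.Nullary.Negation using (contradiction)
open import Relation.Unary using (Pred)

module _ {a ℓ₁ ℓ₂ : Level} (P : Poset a ℓ₁ ℓ₂) where
  open Poset P

  IsChain : Pred Carrier a → Set (a ⊔ ℓ₂)
  IsChain C = ∀ x y → C x → C y → x ≤ y ⊎ y ≤ x

  HasUpperBound : Pred Carrier a → Set (a ⊔ ℓ₂)
  HasUpperBound C = ∃ λ u → ∀ x → C x → x ≤ u

  HasMaximalElement : Set (a ⊔ ℓ₁ ⊔ ℓ₂)
  HasMaximalElement = ∃ λ m → ∀ x → m ≤ x → x ≈ m

-- Zorn's lemma and ExcludedMiddle make explicit the classical foundations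
-- without which maximal congruences need not exist.
ZornsLemma : (a ℓ₁ ℓ₂ : Level) → Set (lsuc (a ⊔ ℓ₁ ⊔ ℓ₂))
ZornsLemma a ℓ₁ ℓ₂ =
  (P : Poset a ℓ₁ ℓ₂) → (∀ C → IsChain P C → HasUpperBound P C) → HasMaximalElement P

module _ {c ℓ₁ ℓ₂ : Level} (L : BoundedLattice c ℓ₁ ℓ₂) where
  open BoundedLattice L renaming (⊤ to 𝟙; ⊥ to 𝟘)

  IsModular : Set (c ⊔ ℓ₁ ⊔ ℓ₂)
  IsModular = ∀ x y z → x ≤ z → (x ∨ y) ∧ z ≈ x ∨ (y ∧ z)

  Complemented : Carrier → Set (c ⊔ ℓ₁)
  Complemented x = ∃ λ y → (x ∨ y ≈ 𝟙) × (x ∧ y ≈ 𝟘)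

record Signature : Set where
  field
    #ops  : ℕ
    arity : Fin #ops → ℕ

  Op : Set
  Op = Fin #ops

open Signature public

data Term (S : Signature) (X : Set) : Set where
  var : X → Term S X
  op  : (f : Op S) → (Fin (arity S f) → Term S X) → Term S X

eval : {S : Signature} {ℓ : Level} {C : Set ℓ} {X : Set} →
       ((f : Op S) → (Fin (arity S f) → C) → C) → Term S X → (X → C) → C
eval I (var x)   v = v x
eval I (op f ts) v = I f (λ i → eval I (ts i) v)

-- Carriers are setoids, so that a quotient algebra keeps the carrier and
-- changes only the equality.  Algebras are nonempty, as is usual.
record Algebra (S : Signature) (ℓ : Level) : Set (lsuc ℓ) where
  infix 4 _≈_
  field
    Carrier       : Set ℓ
    _≈_           : Rel Carrier ℓ
    isEquivalence : IsEquivalence _≈_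
    ⟦_⟧op         : (f : Op S) → (Fin (arity S f) → Carrier) → Carrier
    op-cong       : ∀ f {xs ys} → (∀ i → xs i ≈ ys i) → ⟦ f ⟧op xs ≈ ⟦ f ⟧op ys
    point         : Carrier

  open IsEquivalence isEquivalence public

  ⟦_⟧ : {X : Set} → Term S X → (X → Carrier) → Carrier
  ⟦ t ⟧ = eval ⟦_⟧op t

module _ {S : Signature} {ℓ : Level} (B : Algebra S ℓ) where
  open Algebra B

  Trivial : Set ℓ
  Trivial = ∀ x y → x ≈ y

  record IsSubuniverse (U : Pred Carrier ℓ) : Set ℓ where
    field
      respects : ∀ {x y} → x ≈ y → U x → U y
      closed   : ∀ f xs → (∀ i → U (xs i)) → U (⟦ f ⟧op xs)

  HasOneElementSubalgebra : Set (lsuc ℓ)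
  HasOneElementSubalgebra =
    Σ (Pred Carrier ℓ) λ U → IsSubuniverse U × (∃ λ a → ∀ x → U x ⇔ x ≈ a)

-- Varieties are presented as equational classes.
record Variety (S : Signature) (ℓ : Level) : Set (lsuc ℓ) where
  field
    Identity : Rel (Term S ℕ) ℓ

open Variety public

infix 4 _⊨_
_⊨_ : {S : Signature} {ℓ : Level} → Algebra S ℓ → Variety S ℓ → Set ℓ
B ⊨ 𝒱 = ∀ s t → Identity 𝒱 s t → ∀ v → ⟦ s ⟧ v ≈ ⟦ t ⟧ v
  where open Algebra B

Semidegenerate : {S : Signature} {ℓ : Level} → Variety S ℓ → Set (lsuc ℓ)
Semidegenerate {S} {ℓ} 𝒱 =
  (B : Algebra S ℓ) → B ⊨ 𝒱 → ¬ Trivial B → ¬ HasOneElementSubalgebra B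

record Congruence {S : Signature} {ℓ : Level} (B : Algebra S ℓ) : Set (lsuc ℓ) where
  open Algebra B using (Carrier; _≈_; ⟦_⟧op)
  infix 4 _~_
  field
    _~_           : Rel Carrier ℓ
    isEquivalence : IsEquivalence _~_
    reflexive     : ∀ {x y} → x ≈ y → x ~ y
    compatible    : ∀ f {xs ys} → (∀ i → xs i ~ ys i) → ⟦ f ⟧op xs ~ ⟦ f ⟧op ys

  open IsEquivalence isEquivalence public using (refl; sym; trans)

module _ {S : Signature} {ℓ : Level} {B : Algebra S ℓ} where
  open Algebra B using (Carrier; _≈_; ⟦_⟧op; ⟦_⟧)
  open Congruence using (_~_)

  infix 4 _⊆_ _≑_

  _⊆_ : Rel (Congruence B) ℓ
  α ⊆ β = ∀ {x y} → _~_ α x y → _~_ β x y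

  _≑_ : Rel (Congruence B) ℓ
  α ≑ β = (α ⊆ β) × (β ⊆ α)

  data Generated (R : Rel Carrier ℓ) : Rel Carrier ℓ where
    base  : ∀ {x y} → R x y → Generated R x y
    eq    : ∀ {x y} → x ≈ y → Generated R x y
    symm  : ∀ {x y} → Generated R x y → Generated R y x
    trans : ∀ {x y z} → Generated R x y → Generated R y z → Generated R x z
    comp  : ∀ f {xs ys} → (∀ i → Generated R (xs i) (ys i)) →
            Generated R (⟦ f ⟧op xs) (⟦ f ⟧op ys)

  Cg : Rel Carrier ℓ → Congruence B
  Cg R = record
    { _~_           = Generated R
    ; isEquivalence = record { refl = eq (Algebra.refl B) ; sym = symm ; trans = trans }
    ; reflexive     = eq
    ; compatible    = comp
    }

  Cg-least : ∀ {R} (γ : Congruence B) → (∀ {x y} → R x y → _~_ γ x y) → Cg R ⊆ γ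
  Cg-least γ h (base r)    = h r
  Cg-least γ h (eq e)      = Congruence.reflexive γ e
  Cg-least γ h (symm p)    = Congruence.sym γ (Cg-least γ h p)
  Cg-least γ h (trans p q) = Congruence.trans γ (Cg-least γ h p) (Cg-least γ h q)
  Cg-least γ h (comp f ps) = Congruence.compatible γ f (λ i → Cg-least γ h (ps i))

  Cg-mono : ∀ {R R′ : Rel Carrier ℓ} → (∀ {x y} → R x y → R′ x y) → Cg R ⊆ Cg R′
  Cg-mono {R′ = R′} h = Cg-least (Cg R′) (base ∘ h)

  Δ : Congruence B
  Δ = record
    { _~_           = _≈_
    ; isEquivalence = Algebra.isEquivalence B
    ; reflexive     = id
    ; compatible    = Algebra.op-cong B
    }

  ∇ : Congruence B
  ∇ = record
    { _~_           = λ _ _ → ⊤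
    ; isEquivalence = record { refl = tt ; sym = λ _ → tt ; trans = λ _ _ → tt }
    ; reflexive     = λ _ → tt
    ; compatible    = λ _ _ → tt
    }

  infixr 7 _∩_
  infixr 6 _∨_

  _∩_ : Congruence B → Congruence B → Congruence B
  α ∩ β = record
    { _~_           = λ x y → _~_ α x y × _~_ β x y
    ; isEquivalence = record
      { refl  = α.refl , β.refl
      ; sym   = λ (p , q) → α.sym p , β.sym q
      ; trans = λ (p , q) (p′ , q′) → α.trans p p′ , β.trans q q′
      }
    ; reflexive     = λ e → α.reflexive e , β.reflexive e
    ; compatible    = λ f h → α.compatible f (proj₁ ∘ h) , β.compatible f (proj₂ ∘ h)
    }
    where
    module α = Congruence α
    module β = Congruence β

  _∨_ : Congruence B → Congruence B → Congruence B
  α ∨ β = Cg (λ x y → _~_ α x y ⊎ _~_ β x y)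

  ∨-least : ∀ α β γ → α ⊆ γ → β ⊆ γ → α ∨ β ⊆ γ
  ∨-least α β γ p q = Cg-least γ [ p , q ]′

  ⋁ : {I : Set ℓ} → (I → Congruence B) → Congruence B
  ⋁ γ = Cg (λ x y → ∃ λ i → _~_ (γ i) x y)

  ⋁-finite : {I : Set ℓ} → (I → Congruence B) → List I → Congruence B
  ⋁-finite γ is = Cg (λ x y → Any (λ i → _~_ (γ i) x y) is)

  Compact : Congruence B → Set (lsuc ℓ)
  Compact α = {I : Set ℓ} (γ : I → Congruence B) → α ⊆ ⋁ γ → ∃ λ is → α ⊆ ⋁-finite γ is

  -- The commutator [ α , β ] is the least δ such that α centralizes β
  -- modulo δ; see commutator-centralizes and commutator-least.

  infixr 5 _⊕_
  _⊕_ : {m n : ℕ} → (Fin m → Carrier) → (Fin n → Carrier) → Fin m ⊎ Fin n → Carrier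
  a ⊕ b = [ a , b ]′

  Centralizes : Congruence B → Congruence B → Congruence B → Set ℓ
  Centralizes α β δ =
    ∀ {m n : ℕ} (t : Term S (Fin m ⊎ Fin n)) (a a′ : Fin m → Carrier) (b b′ : Fin n → Carrier) →
    (∀ i → _~_ α (a i) (a′ i)) → (∀ j → _~_ β (b j) (b′ j)) →
    _~_ δ (⟦ t ⟧ (a ⊕ b)) (⟦ t ⟧ (a ⊕ b′)) → _~_ δ (⟦ t ⟧ (a′ ⊕ b)) (⟦ t ⟧ (a′ ⊕ b′))

  data Commutator (α β : Congruence B) : Rel Carrier ℓ where
    eq    : ∀ {x y} → x ≈ y → Commutator α β x y
    symm  : ∀ {x y} → Commutator α β x y → Commutator α β y x
    trans : ∀ {x y z} → Commutator α β x y → Commutator α β y z → Commutator α β x z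
    comp  : ∀ f {xs ys} → (∀ i → Commutator α β (xs i) (ys i)) →
            Commutator α β (⟦ f ⟧op xs) (⟦ f ⟧op ys)
    term  : ∀ {m n : ℕ} (t : Term S (Fin m ⊎ Fin n)) (a a′ : Fin m → Carrier) (b b′ : Fin n → Carrier) →
            (∀ i → _~_ α (a i) (a′ i)) → (∀ j → _~_ β (b j) (b′ j)) →
            Commutator α β (⟦ t ⟧ (a ⊕ b)) (⟦ t ⟧ (a ⊕ b′)) →
            Commutator α β (⟦ t ⟧ (a′ ⊕ b)) (⟦ t ⟧ (a′ ⊕ b′))

  [_,_] : Congruence B → Congruence B → Congruence B
  [ α , β ] = record
    { _~_           = Commutator α β
    ; isEquivalence = record { refl = eq (Algebra.refl B) ; sym = symm ; trans = trans }
    ; reflexive     = eq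
    ; compatible    = comp
    }

  commutator-centralizes : ∀ α β → Centralizes α β [ α , β ]
  commutator-centralizes α β = term

  commutator-least : ∀ α β δ → Centralizes α β δ → [ α , β ] ⊆ δ
  commutator-least α β δ c (eq e)      = Congruence.reflexive δ e
  commutator-least α β δ c (symm p)    = Congruence.sym δ (commutator-least α β δ c p)
  commutator-least α β δ c (trans p q) =
    Congruence.trans δ (commutator-least α β δ c p) (commutator-least α β δ c q)
  commutator-least α β δ c (comp f ps) =
    Congruence.compatible δ f (λ i → commutator-least α β δ c (ps i))
  commutator-least α β δ c (term t a a′ b b′ p q r) =
    c t a a′ b b′ p q (commutator-least α β δ c r)

  term-compatible : (α : Congruence B) {X : Set} (t : Term S X) {v v′ : X → Carrier} →
    (∀ x → _~_ α (v x) (v′ x)) → _~_ α (⟦ t ⟧ v) (⟦ t ⟧ v′)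
  term-compatible α (var x)   h = h x
  term-compatible α (op f ts) h = Congruence.compatible α f (λ i → term-compatible α (ts i) h)

  commutator-⊆ˡ : ∀ α β → [ α , β ] ⊆ α
  commutator-⊆ˡ α β = commutator-least α β α λ t a a′ b b′ p q r →
    α.trans (α.sym (move t a a′ b p)) (α.trans r (move t a a′ b′ p))
    where
    module α = Congruence α
    move : ∀ {m n : ℕ} (t : Term S (Fin m ⊎ Fin n)) (a a′ : Fin m → Carrier) (b : Fin n → Carrier) →
           (∀ i → _~_ α (a i) (a′ i)) → _~_ α (⟦ t ⟧ (a ⊕ b)) (⟦ t ⟧ (a′ ⊕ b))
    move t a a′ b p = term-compatible α t λ { (inj₁ i) → p i ; (inj₂ j) → α.refl }

  commutator-⊆ʳ : ∀ α β → [ α , β ] ⊆ β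
  commutator-⊆ʳ α β = commutator-least α β β λ t a a′ b b′ p q r →
    term-compatible β t λ { (inj₁ i) → Congruence.refl β ; (inj₂ j) → q j }

  Prime : Congruence B → Set (lsuc ℓ)
  Prime φ = ¬ (φ ≑ ∇) × (∀ α β → [ α , β ] ⊆ φ → (α ⊆ φ) ⊎ (β ⊆ φ))

  Maximal : Congruence B → Set (lsuc ℓ)
  Maximal μ = ¬ (μ ≑ ∇) × (∀ ψ → μ ⊆ ψ → ¬ (ψ ≑ ∇) → ψ ≑ μ)

  -- An intersection over a family of congruences (so too Rad below), hence a
  -- relation one universe up.
  ρ : Congruence B → Rel Carrier (lsuc ℓ)
  ρ θ x y = ∀ φ → Prime φ → θ ⊆ φ → _~_ φ x y

Con : {S : Signature} {ℓ : Level} → Algebra S ℓ → BoundedLattice (lsuc ℓ) ℓ ℓ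
Con B = record
  { Carrier          = Congruence B
  ; _≈_              = _≑_
  ; _≤_              = _⊆_
  ; _∨_              = _∨_
  ; _∧_              = _∩_
  ; ⊤                = ∇
  ; ⊥                = Δ
  ; isBoundedLattice = record
    { isLattice = record
      { isPartialOrder = record
        { isPreorder = record
          { isEquivalence = record
            { refl  = id , id
            ; sym   = swap
            ; trans = λ (p , p′) (q , q′) → (λ r → q (p r)) , (λ r → p′ (q′ r))
            }
          ; reflexive = λ e → proj₁ e
          ; trans     = λ p q r → q (p r)
          }
        ; antisym = λ p q → p , q
        }
      ; supremum = λ α β → (λ r → base (inj₁ r)) , (λ r → base (inj₂ r)) , λ γ → ∨-least α β γ
      ; infimum  = λ α β → proj₁ , proj₂ , λ γ p q r → p r , q r
      }
    ; maximum = λ _ _ → tt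
    ; minimum = λ α → Congruence.reflexive α
    }
  }

module _ {S : Signature} {ℓ : Level} (B : Algebra S ℓ) where
  open Algebra B using (Carrier)
  open Congruence using (_~_)

  Rad : Rel Carrier (lsuc ℓ)
  Rad x y = ∀ (μ : Congruence B) → Maximal μ → _~_ μ x y

  IsBNormal : Set (lsuc ℓ)
  IsBNormal = (χ ε : Congruence B) → χ ∨ ε ≑ ∇ →
    ∃ λ α → ∃ λ β → Complemented (Con B) α × Complemented (Con B) β ×
      (χ ∨ α ≑ ∇) × (ε ∨ β ≑ ∇) × ([ α , β ] ≑ Δ)

CongruenceModular : {S : Signature} {ℓ : Level} → Variety S ℓ → Set (lsuc ℓ)
CongruenceModular {S} {ℓ} 𝒱 = (B : Algebra S ℓ) → B ⊨ 𝒱 → IsModular (Con B)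

infixl 8 _/_
_/_ : {S : Signature} {ℓ : Level} (A : Algebra S ℓ) → Congruence A → Algebra S ℓ
A / θ = record
  { Carrier       = Algebra.Carrier A
  ; _≈_           = Congruence._~_ θ
  ; isEquivalence = Congruence.isEquivalence θ
  ; ⟦_⟧op         = Algebra.⟦_⟧op A
  ; op-cong       = Congruence.compatible θ
  ; point         = Algebra.point A
  }

module _ {S : Signature} {ℓ : Level} {A : Algebra S ℓ} where

  -- γ / θ for a congruence γ ⊇ θ.
  quotientCongruence : (θ γ : Congruence A) → θ ⊆ γ → Congruence (A / θ)
  quotientCongruence θ γ θ⊆γ = record
    { _~_           = Congruence._~_ γ
    ; isEquivalence = Congruence.isEquivalence γ
    ; reflexive     = θ⊆γ
    ; compatible    = Congruence.compatible γ
    }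

  -- (α ∨ θ) / θ
  infixl 6 _∨/_
  _∨/_ : (α θ : Congruence A) → Congruence (A / θ)
  α ∨/ θ = quotientCongruence θ (α ∨ θ) (λ r → base (inj₂ r))

  HasCBLP : Congruence A → Set (lsuc ℓ)
  HasCBLP θ = (β : Congruence (A / θ)) → Complemented (Con (A / θ)) β →
    ∃ λ α → Complemented (Con A) α × (α ∨/ θ ≑ β)

  quotient-⊨ : (𝒱 : Variety S ℓ) → A ⊨ 𝒱 → (θ : Congruence A) → A / θ ⊨ 𝒱
  quotient-⊨ 𝒱 A⊨𝒱 θ s t s≈t v = Congruence.reflexive θ (A⊨𝒱 s t s≈t v)

module _ {S : Signature} {ℓ : Level} {B : Algebra S ℓ} where
  open Algebra B using (Carrier; _≈_; ⟦_⟧op; point)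
  open Congruence using (_~_)

  Δ-compact : Compact {B = B} Δ
  Δ-compact γ _ = [] , eq

  ∨-compact : (α β : Congruence B) → Compact α → Compact β → Compact (α ∨ β)
  ∨-compact α β cα cβ γ h with cα γ (λ r → h (base (inj₁ r))) | cβ γ (λ r → h (base (inj₂ r)))
  ... | is , p | js , q = is ++ js ,
    ∨-least α β (⋁-finite γ (is ++ js)) (λ r → Cg-mono ++⁺ˡ (p r)) (λ r → Cg-mono (++⁺ʳ is) (q r))

  module _ {I : Set ℓ} (γ : I → Congruence B) where

    ⋁-finite-concat : {n : ℕ} (is : Fin n → List I) (k : Fin n) →
      ⋁-finite γ (is k) ⊆ ⋁-finite γ (concat (tabulate is))
    ⋁-finite-concat is k = Cg-mono λ r → concat⁺ (tabulate⁺ k r)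

    ⋁-finitary : ∀ {x y} → _~_ (⋁ γ) x y → ∃ λ is → _~_ (⋁-finite γ is) x y
    ⋁-finitary (base (i , r)) = i ∷ [] , base (here r)
    ⋁-finitary (eq e)         = [] , eq e
    ⋁-finitary (symm p)       = let is , p′ = ⋁-finitary p in is , symm p′
    ⋁-finitary (trans p q)    =
      let is , p′ = ⋁-finitary p
          js , q′ = ⋁-finitary q
      in is ++ js , trans (Cg-mono ++⁺ˡ p′) (Cg-mono (++⁺ʳ is) q′)
    ⋁-finitary (comp f {xs} {ys} ps) =
      concat (tabulate is) , comp f λ k → ⋁-finite-concat is k (proj₂ (rec k))
      where
      rec : ∀ k → ∃ λ js → _~_ (⋁-finite γ js) (xs k) (ys k)
      rec k = ⋁-finitary (ps k)
      is : Fin (arity S f) → List I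
      is k = proj₁ (rec k)

  -- The signature being finite, ∇ is generated by the finitely many pairs
  -- (f(a,…,a) , a): collapsing them makes {a} a subalgebra.
  ∇-compact : ExcludedMiddle (lsuc ℓ) → (𝒱 : Variety S ℓ) → Semidegenerate 𝒱 →
              B ⊨ 𝒱 → Compact {B = B} ∇
  ∇-compact em 𝒱 sd B⊨𝒱 {I} γ h = js , λ {x} {y} _ → trivial x y
    where
    a : Carrier
    a = point

    rec : ∀ f → ∃ λ is → _~_ (⋁-finite γ is) (⟦ f ⟧op (λ _ → a)) a
    rec f = ⋁-finitary γ (h tt)

    js : List I
    js = concat (tabulate (λ f → proj₁ (rec f)))

    ψ : Congruence B
    ψ = ⋁-finite γ js

    collapse : ∀ f → _~_ ψ (⟦ f ⟧op (λ _ → a)) a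
    collapse f = ⋁-finite-concat γ (λ f → proj₁ (rec f)) f (proj₂ (rec f))

    oneElement : HasOneElementSubalgebra (B / ψ)
    oneElement = (λ x → _~_ ψ x a)
      , record
        { respects = λ e p → trans (symm e) p
        ; closed   = λ f xs ps → trans (comp f ps) (collapse f)
        }
      , a , λ x → mk⇔ id id

    trivial : Trivial (B / ψ)
    trivial with em {Lift (lsuc ℓ) (Trivial (B / ψ))}
    ... | yes (lift t) = t
    ... | no ¬t = contradiction oneElement (sd (B / ψ) (quotient-⊨ 𝒱 B⊨𝒱 ψ) (λ t → ¬t (lift t)))

CommutatorPreservesCompact : {S : Signature} {ℓ : Level} → Algebra S ℓ → Set (lsuc ℓ)
CommutatorPreservesCompact B =
  (α β : Congruence B) → Compact α → Compact β → Compact [ α , β ]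

module _ {S : Signature} {ℓ : Level} (B : Algebra S ℓ)
         (c∇ : Compact {B = B} ∇) (c[] : CommutatorPreservesCompact B) where

  K : Set (lsuc ℓ)
  K = Σ (Congruence B) Compact

  private
    infix 4 _≼_
    _≼_ : Rel K (lsuc ℓ)
    (α , _) ≼ (β , _) = ∀ {x y} → ρ α x y → ρ β x y

    intro : (a b : K) → (∀ φ → Prime φ → proj₁ b ⊆ φ → proj₁ a ⊆ φ) → a ≼ b
    intro a b h r φ pr b⊆φ = r φ pr (h φ pr b⊆φ)

    elim : (a b : K) → a ≼ b → ∀ φ → Prime φ → proj₁ b ⊆ φ → proj₁ a ⊆ φ
    elim a b a≼b φ pr b⊆φ r = a≼b (λ ψ _ a⊆ψ → a⊆ψ r) φ pr b⊆φ

    _⊔ᴷ_ _⊓ᴷ_ : K → K → K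
    (α , cα) ⊔ᴷ (β , cβ) = α ∨ β , ∨-compact α β cα cβ
    (α , cα) ⊓ᴷ (β , cβ) = [ α , β ] , c[] α β cα cβ

  -- The reticulation K(B)/≡ as a setoid: α ≡ β iff ρ(α) = ρ(β), with
  -- λα ∨ λβ = λ(α ∨ β) and λα ∧ λβ = λ[α,β].
  L : BoundedLattice (lsuc ℓ) (lsuc ℓ) (lsuc ℓ)
  L = record
    { Carrier          = K
    ; _≈_              = λ a b → (a ≼ b) × (b ≼ a)
    ; _≤_              = _≼_
    ; _∨_              = _⊔ᴷ_
    ; _∧_              = _⊓ᴷ_
    ; ⊤                = ∇ , c∇
    ; ⊥                = Δ , Δ-compact
    ; isBoundedLattice = record
      { isLattice = record
        { isPartialOrder = record
          { isPreorder = record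
            { isEquivalence = record
              { refl  = id , id
              ; sym   = swap
              ; trans = λ (p , p′) (q , q′) → (λ r → q (p r)) , (λ r → p′ (q′ r))
              }
            ; reflexive = λ e → proj₁ e
            ; trans     = λ p q r → q (p r)
            }
          ; antisym = λ p q → p , q
          }
        ; supremum = λ a b →
            intro a (a ⊔ᴷ b) (λ φ _ h r → h (base (inj₁ r))) ,
            intro b (a ⊔ᴷ b) (λ φ _ h r → h (base (inj₂ r))) ,
            λ c p q → intro (a ⊔ᴷ b) c λ φ pr h →
              ∨-least (proj₁ a) (proj₁ b) φ (elim a c p φ pr h) (elim b c q φ pr h)
        ; infimum = λ a b →
            intro (a ⊓ᴷ b) a (λ φ _ h r → h (commutator-⊆ˡ (proj₁ a) (proj₁ b) r)) ,
            intro (a ⊓ᴷ b) b (λ φ _ h r → h (commutator-⊆ʳ (proj₁ a) (proj₁ b) r)) ,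
            λ c p q → intro c (a ⊓ᴷ b) λ φ pr h →
              [ elim c a p φ pr , elim c b q φ pr ]′ (proj₂ pr (proj₁ a) (proj₁ b) h)
        }
      ; maximum = λ a → intro a (∇ , c∇) (λ φ _ h r → h tt)
      ; minimum = λ a → intro (Δ , Δ-compact) a (λ φ _ _ → Congruence.reflexive φ)
      }
    }

  L-distributive : let open BoundedLattice L using () renaming (_≤_ to _≤ᴸ_; _∨_ to _∨ᴸ_; _∧_ to _∧ᴸ_) in
    ∀ a b c → (a ∧ᴸ (b ∨ᴸ c)) ≤ᴸ ((a ∧ᴸ b) ∨ᴸ (a ∧ᴸ c))
  L-distributive a b c = intro (a ⊓ᴷ (b ⊔ᴷ c)) ((a ⊓ᴷ b) ⊔ᴷ (a ⊓ᴷ c)) go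
    where
    α = proj₁ a
    β = proj₁ b
    γ = proj₁ c
    go : ∀ φ → Prime φ → [ α , β ] ∨ [ α , γ ] ⊆ φ → [ α , β ∨ γ ] ⊆ φ
    go φ pr h with proj₂ pr α β (λ r → h (base (inj₁ r))) | proj₂ pr α γ (λ r → h (base (inj₂ r)))
    ... | inj₁ α⊆φ | _        = λ r → α⊆φ (commutator-⊆ˡ α (β ∨ γ) r)
    ... | inj₂ _   | inj₁ α⊆φ = λ r → α⊆φ (commutator-⊆ˡ α (β ∨ γ) r)
    ... | inj₂ β⊆φ | inj₂ γ⊆φ = λ r → ∨-least β γ φ β⊆φ γ⊆φ (commutator-⊆ʳ α (β ∨ γ) r)

  -- The canonical map λ_B (λ is reserved).
  λᴮ : (α : Congruence B) → Compact α → K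
  λᴮ α cα = α , cα

  ReticulationPreservesBooleanCenter : Set (lsuc ℓ)
  ReticulationPreservesBooleanCenter =
    ∀ a → Complemented L a →
    ∃ λ α → Σ (Compact α) λ cα → Complemented (Con B) α × BoundedLattice._≈_ L (λᴮ α cα) a

{-# OPTIONS --safe #-}
-- Let β′ and α′ be the complemented congruences of A/θ given by B-normality, let
-- α lift α′, and let α₁ be a complement of α.  The pair (α , α₁) works for A:
-- [α,α₁] ⊆ α ∩ α₁ = Δ holds outright, and since joins with θ ⊆ Rad(A) can be
-- cancelled in equations ψ ∨ θ = ∇, it is enough that β′ ⊆ (α₁ ∨ θ)/θ.
--
-- This follows from one consequence of semidegeneracy: if α ∨ κ = ∇ and both α
-- and κ centralize β modulo δ, then β ⊆ δ.  Indeed, on β, viewed as a subalgebra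
-- of the square, the largest congruence for which β ∩ δ is a union of classes
-- then collapses the diagonal to a one-element subalgebra, so it is trivial.
-- Applied to α′ ∩ β′ modulo Δ this gives α′ ∩ β′ = Δ; by modularity α′ then
-- centralizes β′ modulo κ ∩ β′, where κ = (α₁ ∨ θ)/θ, and a second application
-- gives β′ ⊆ κ.
module Submission where

open import Defs
open import Axiom.ExcludedMiddle using (ExcludedMiddle)
open import Data.Empty using (⊥-elim)
open import Data.Fin using (Fin; zero; suc; _↑ˡ_; _↑ʳ_; splitAt; _≟_)
open import Data.Fin.Properties using (splitAt-↑ˡ; splitAt-↑ʳ)
open import Data.Nat using (ℕ; zero; suc; _+_)
open import Data.Product using (Σ; ∃; _×_; _,_; proj₁; proj₂)
open import Data.Sum using (_⊎_; inj₁; inj₂; [_,_]′)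
open import Data.Unit.Polymorphic using (tt)
open import Data.Vec.Functional using (_∷_)
open import Function using (_∘_; id; mk⇔)
open import Level using (Level; Lift; lift; lower) renaming (suc to lsuc)
open import Relation.Binary using (Rel; Poset)
open import Relation.Binary.PropositionalEquality as ≡ using (_≡_; _≢_)
open import Relation.Nullary using (¬_; Dec; yes; no; contradiction)
open import Relation.Nullary.Decidable using (True; toWitness; fromWitness)
open import Relation.Unary using (Pred)

-- Terms, substitution and the syntactic congruence of a predicate.

module _ {S : Signature} where

  substitute : {X Y : Set} → Term S X → (X → Term S Y) → Term S Y
  substitute (var x)   σ = σ x
  substitute (op f ts) σ = op f (λ i → substitute (ts i) σ)

  module _ {ℓ : Level} (B : Algebra S ℓ) where
    open Algebra B renaming (trans to ≈-trans)

    eval-substitute : {X Y : Set} (t : Term S X) (σ : X → Term S Y) (v : Y → Carrier) →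
      ⟦ substitute t σ ⟧ v ≈ ⟦ t ⟧ (λ x → ⟦ σ x ⟧ v)
    eval-substitute (var x)   σ v = refl
    eval-substitute (op f ts) σ v = op-cong f (λ i → eval-substitute (ts i) σ v)

    eval-cong : {X : Set} (t : Term S X) {v v′ : X → Carrier} →
      (∀ x → v x ≈ v′ x) → ⟦ t ⟧ v ≈ ⟦ t ⟧ v′
    eval-cong = term-compatible (Δ {B = B})

-- Passes from `xs` to `ys` by changing one entry at a time. The hypothesis on pointwise equal
-- tuples replaces function extensionality, as tuples rebuilt with `_∷_` match the originals only
-- pointwise.
coordinatewise : {c r : Level} {C : Set c} (R : Rel C r) →
  (∀ {x} → R x x) → (∀ {x y z} → R x y → R y z → R x z) →
  (n : ℕ) (F : (Fin n → C) → C) →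
  (∀ xs ys → (∀ j → xs j ≡ ys j) → R (F xs) (F ys)) →
  (∀ i xs ys → (∀ j → j ≢ i → xs j ≡ ys j) → R (xs i) (ys i) → R (F xs) (F ys)) →
  ∀ xs ys → (∀ j → R (xs j) (ys j)) → R (F xs) (F ys)
coordinatewise R R-refl R-trans zero    F ext one xs ys h = ext xs ys λ ()
coordinatewise R R-refl R-trans (suc n) F ext one xs ys h =
  R-trans (one zero xs (ys zero ∷ (xs ∘ suc))
            (λ { zero 0≢0 → ⊥-elim (0≢0 ≡.refl) ; (suc j) _ → ≡.refl }) (h zero))
  (R-trans
    (coordinatewise R R-refl R-trans n (λ zs → F (ys zero ∷ zs))
      (λ us vs e → ext _ _ λ { zero → ≡.refl ; (suc j) → e j })
      (λ i us vs e r → one (suc i) _ _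
        (λ { zero _ → ≡.refl ; (suc j) j≢i → e j (j≢i ∘ ≡.cong suc) }) r)
      (xs ∘ suc) (ys ∘ suc) (h ∘ suc))
    (ext _ _ λ { zero → ≡.refl ; (suc j) → ≡.refl }))

-- The largest congruence for which the predicate D is a union of classes.
module Syntactic {S : Signature} {ℓ : Level} (E : Algebra S ℓ)
  (D : Pred (Algebra.Carrier E) ℓ) (D-resp : ∀ {x y} → Algebra._≈_ E x y → D x → D y) where
  open Algebra E renaming (trans to ≈-trans)

  infix 4 _≲_
  -- `D` is tested along all unary polynomials `t(-, c)`; the single slot `Fin 1` fits the term
  -- condition in `Centralizes`.
  _≲_ : Rel Carrier ℓ
  p ≲ q = ∀ {n} (t : Term S (Fin 1 ⊎ Fin n)) (c : Fin n → Carrier) →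
    D (⟦ t ⟧ [ (λ _ → p) , c ]′) → D (⟦ t ⟧ [ (λ _ → q) , c ]′)

  ≈⇒≲ : ∀ {p q} → p ≈ q → p ≲ q
  ≈⇒≲ p≈q t c = D-resp (eval-cong E t λ { (inj₁ _) → p≈q ; (inj₂ _) → refl })

  module _ (f : Op S) (i : Fin (arity S f)) {n : ℕ} (t : Term S (Fin 1 ⊎ Fin n)) where

    -- Together with `σ`, turns `t(f(...), c)` into a unary polynomial in the `i`-th argument of
    -- `f`: the other arguments become parameters in front of `c`. The decision is an explicit
    -- argument so that `arg` can match on it.
    σ-arg : (j : Fin (arity S f)) → Dec (j ≡ i) → Term S (Fin 1 ⊎ Fin (arity S f + n))
    σ-arg j (yes _) = var (inj₁ zero)
    σ-arg j (no _)  = var (inj₂ (j ↑ˡ n))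

    σ : Fin 1 ⊎ Fin n → Term S (Fin 1 ⊎ Fin (arity S f + n))
    σ (inj₁ _) = op f (λ j → σ-arg j (j ≟ i))
    σ (inj₂ j) = var (inj₂ (arity S f ↑ʳ j))

    params : (Fin (arity S f) → Carrier) → (Fin n → Carrier) → Fin (arity S f + n) → Carrier
    params xs c = [ xs , c ]′ ∘ splitAt (arity S f)

    eval-σ : ∀ xs zs c → (∀ j → j ≢ i → xs j ≡ zs j) →
      ⟦ substitute t σ ⟧ [ (λ _ → zs i) , params xs c ]′ ≈ ⟦ t ⟧ [ (λ _ → ⟦ f ⟧op zs) , c ]′
    eval-σ xs zs c e = ≈-trans (eval-substitute E t σ _) (eval-cong E t λ
      { (inj₁ _) → op-cong f (λ j → arg j (j ≟ i))
      ; (inj₂ j) → reflexive (≡.cong [ xs , c ]′ (splitAt-↑ʳ (arity S f) n j)) })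
      where
      arg : ∀ j d → ⟦ σ-arg j d ⟧ [ (λ _ → zs i) , params xs c ]′ ≈ zs j
      arg j (yes ≡.refl) = refl
      arg j (no j≢i)     =
        reflexive (≡.trans (≡.cong [ xs , c ]′ (splitAt-↑ˡ (arity S f) j n)) (e j j≢i))

  ≲-compatible : ∀ f {xs ys} → (∀ i → xs i ≲ ys i) → ⟦ f ⟧op xs ≲ ⟦ f ⟧op ys
  ≲-compatible f {xs} {ys} h = coordinatewise _≲_ (λ t c d → d) (λ r s t c d → s t c (r t c d))
    (arity S f) ⟦ f ⟧op (λ us vs e → ≈⇒≲ (op-cong f (reflexive ∘ e))) one xs ys h
    where
    one : ∀ i us vs → (∀ j → j ≢ i → us j ≡ vs j) → us i ≲ vs i → ⟦ f ⟧op us ≲ ⟦ f ⟧op vs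
    -- As `us` and `vs` agree off `i`, one polynomial with parameters from `us` gives both values:
    -- at `us i` and at `vs i`.
    one i us vs e r t c d = D-resp (eval-σ f i t us vs c e)
      (r (substitute t (σ f i t)) (params f i t us c)
        (D-resp (sym (eval-σ f i t us us c (λ _ _ → ≡.refl))) d))

  syntactic : Congruence E
  syntactic = record
    { _~_           = λ p q → (p ≲ q) × (q ≲ p)
    ; isEquivalence = record
      { refl  = (λ t c d → d) , (λ t c d → d)
      ; sym   = λ (r , s) → s , r
      ; trans = λ (r , s) (r′ , s′) → (λ t c d → r′ t c (r t c d)) , (λ t c d → s t c (s′ t c d))
      }
    ; reflexive     = λ e → ≈⇒≲ e , ≈⇒≲ (sym e)
    ; compatible    = λ f h → ≲-compatible f (proj₁ ∘ h) , ≲-compatible f (proj₂ ∘ h)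
    }

-- Congruences as subalgebras of the square, and the term condition.

module _ {S : Signature} {ℓ : Level} {B : Algebra S ℓ} where
  open Algebra B renaming (trans to ≈-trans)
  open Congruence using (_~_)

  subalgebraOfSquare : Congruence B → Algebra S ℓ
  subalgebraOfSquare β = record
    { Carrier       = Σ (Carrier × Carrier) λ (x , y) → _~_ β x y
    ; _≈_           = λ ((x , y) , _) ((u , v) , _) → (x ≈ u) × (y ≈ v)
    ; isEquivalence = record
      { refl  = refl , refl
      ; sym   = λ (p , q) → sym p , sym q
      ; trans = λ (p , q) (p′ , q′) → ≈-trans p p′ , ≈-trans q q′
      }
    ; ⟦_⟧op         = λ f ps →
        (⟦ f ⟧op (proj₁ ∘ proj₁ ∘ ps) , ⟦ f ⟧op (proj₂ ∘ proj₁ ∘ ps)) ,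
        Congruence.compatible β f (proj₂ ∘ ps)
    ; op-cong       = λ f h → op-cong f (proj₁ ∘ h) , op-cong f (proj₂ ∘ h)
    ; point         = (point , point) , Congruence.refl β
    }

  module _ (β : Congruence B) where
    private module E = Algebra (subalgebraOfSquare β)

    eval-proj₁ : {X : Set} (t : Term S X) (v : X → E.Carrier) →
      proj₁ (proj₁ (E.⟦ t ⟧ v)) ≈ ⟦ t ⟧ (proj₁ ∘ proj₁ ∘ v)
    eval-proj₁ (var x)   v = refl
    eval-proj₁ (op f ts) v = op-cong f (λ i → eval-proj₁ (ts i) v)

    eval-proj₂ : {X : Set} (t : Term S X) (v : X → E.Carrier) →
      proj₂ (proj₁ (E.⟦ t ⟧ v)) ≈ ⟦ t ⟧ (proj₂ ∘ proj₁ ∘ v)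
    eval-proj₂ (var x)   v = refl
    eval-proj₂ (op f ts) v = op-cong f (λ i → eval-proj₂ (ts i) v)

    subalgebraOfSquare-⊨ : (𝒱 : Variety S ℓ) → B ⊨ 𝒱 → subalgebraOfSquare β ⊨ 𝒱
    subalgebraOfSquare-⊨ 𝒱 B⊨𝒱 s t s≈t v =
      ≈-trans (eval-proj₁ s v) (≈-trans (B⊨𝒱 s t s≈t _) (sym (eval-proj₁ t v))) ,
      ≈-trans (eval-proj₂ s v) (≈-trans (B⊨𝒱 s t s≈t _) (sym (eval-proj₂ t v)))

  -- Replacing `a` by `a′` moves each value within `κ`, so the two values at `a′` are related by
  -- `δ ∨ κ`; they are related by `β` because `b` and `b′` are.
  centralizes-if : (κ β δ : Congruence B) → (δ ∨ κ) ∩ β ⊆ δ → Centralizes κ β δ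
  centralizes-if κ β δ h t a a′ b b′ p q r = h
    ( trans (symm (move b)) (trans (base (inj₁ r)) (move b′))
    , term-compatible β t (λ { (inj₁ i) → Congruence.refl β ; (inj₂ j) → q j }) )
    where
    move : ∀ c → _~_ (δ ∨ κ) (⟦ t ⟧ [ a , c ]′) (⟦ t ⟧ [ a′ , c ]′)
    move c = base (inj₂ (term-compatible κ t λ { (inj₁ i) → p i ; (inj₂ j) → Congruence.refl κ }))

-- Consequences of semidegeneracy.

module _ {S : Signature} {ℓ : Level} (em : ExcludedMiddle (lsuc ℓ))
         (𝒱 : Variety S ℓ) (sd : Semidegenerate 𝒱) where
  open Congruence using (_~_)

  stable : {P : Set ℓ} → ¬ ¬ P → P
  stable {P} ¬¬p with em {Lift (lsuc ℓ) P}
  ... | yes (lift p) = p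
  ... | no ¬p        = contradiction (¬p ∘ lift) ¬¬p

  oneElementSubalgebra⇒trivial : (B : Algebra S ℓ) → B ⊨ 𝒱 → HasOneElementSubalgebra B → Trivial B
  oneElementSubalgebra⇒trivial B B⊨𝒱 one = stable {Trivial B} λ ¬trivial → sd B B⊨𝒱 ¬trivial one

  -- The class of `a` is closed under the operations, hence a one-element subalgebra of `B / φ`.
  idempotent-class⇒∇ : (B : Algebra S ℓ) → B ⊨ 𝒱 → (φ : Congruence B) (a : Algebra.Carrier B) →
    (∀ f → _~_ φ (Algebra.⟦_⟧op B f (λ _ → a)) a) → ∀ x y → _~_ φ x y
  idempotent-class⇒∇ B B⊨𝒱 φ a idem =
    oneElementSubalgebra⇒trivial (B / φ) (quotient-⊨ 𝒱 B⊨𝒱 φ)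
      ( (λ x → _~_ φ x a)
      , record
        { respects = λ e p → φ.trans (φ.sym e) p
        ; closed   = λ f xs ps → φ.trans (φ.compatible f ps) (idem f)
        }
      , a , λ x → mk⇔ id id )
    where
    module φ = Congruence φ

  module _ {B : Algebra S ℓ} (B⊨𝒱 : B ⊨ 𝒱) where
    open Algebra B renaming (trans to ≈-trans)

    centralized⇒⊆ : (α κ β δ : Congruence B) → α ∨ κ ≑ ∇ →
      Centralizes α β δ → Centralizes κ β δ → β ⊆ δ
    centralized⇒⊆ α κ β δ (_ , ∇⊆α∨κ) cα cκ {x} {y} xβy =
      -- The bare variable is the test polynomial: a diagonal pair lies in `δ`, so `(x , y)` does
      -- too.
      proj₂ (all ((x , y) , xβy) (diagonal point)) {0} (var (inj₁ zero)) (λ ()) δ.refl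
      where
      E = subalgebraOfSquare β
      module E = Algebra E
      module β = Congruence β
      module δ = Congruence δ

      open Syntactic E (λ ((u , v) , _) → _~_ δ u v)
        (λ (p , q) r → δ.trans (δ.sym (δ.reflexive p)) (δ.trans r (δ.reflexive q)))
      module Θ = Congruence syntactic

      diagonal : Carrier → E.Carrier
      diagonal u = (u , u) , β.refl

      onDiagonal : Congruence B
      onDiagonal = record
        { _~_           = λ u v → diagonal u Θ.~ diagonal v
        ; isEquivalence = record { refl = Θ.refl ; sym = Θ.sym ; trans = Θ.trans }
        ; reflexive     = λ e → Θ.reflexive (e , e)
        -- `f` applied to diagonal pairs and the diagonal pair of the value differ only in the proof
        -- of `β`-relatedness, which equality in `E` ignores.
        ; compatible    = λ f h → Θ.trans (Θ.reflexive (refl , refl))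
            (Θ.trans (Θ.compatible f h) (Θ.reflexive (refl , refl)))
        }

      -- Parameters from `E` are `β`-related pairs, so the test at `diagonal u` says that two values
      -- of `t` at `u` are `δ`-related; the term condition moves this to `v`.
      centralizes⇒≲ : (γ : Congruence B) → Centralizes γ β δ →
        ∀ {u v} → _~_ γ u v → diagonal u ≲ diagonal v
      centralizes⇒≲ γ c {u} {v} uγv {n} t e d =
        δ.trans (δ.reflexive (left v)) (δ.trans
          (c t (λ _ → u) (λ _ → v) (proj₁ ∘ proj₁ ∘ e) (proj₂ ∘ proj₁ ∘ e) (λ _ → uγv) (proj₂ ∘ e)
            (δ.trans (δ.sym (δ.reflexive (left u))) (δ.trans d (δ.reflexive (right u)))))
          (δ.sym (δ.reflexive (right v))))
        where
        left : ∀ w → proj₁ (proj₁ (E.⟦ t ⟧ [ (λ _ → diagonal w) , e ]′)) ≈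
                     ⟦ t ⟧ [ (λ _ → w) , proj₁ ∘ proj₁ ∘ e ]′
        left w = ≈-trans (eval-proj₁ β t _)
          (eval-cong B t λ { (inj₁ _) → refl ; (inj₂ _) → refl })
        right : ∀ w → proj₂ (proj₁ (E.⟦ t ⟧ [ (λ _ → diagonal w) , e ]′)) ≈
                      ⟦ t ⟧ [ (λ _ → w) , proj₂ ∘ proj₁ ∘ e ]′
        right w = ≈-trans (eval-proj₂ β t _)
          (eval-cong B t λ { (inj₁ _) → refl ; (inj₂ _) → refl })

      centralizes⇒⊆ : (γ : Congruence B) → Centralizes γ β δ → γ ⊆ onDiagonal
      centralizes⇒⊆ γ c r = centralizes⇒≲ γ c r , centralizes⇒≲ γ c (Congruence.sym γ r)

      diagonal-collapses : ∀ u v → diagonal u Θ.~ diagonal v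
      diagonal-collapses u v =
        ∨-least α κ onDiagonal (centralizes⇒⊆ α cα) (centralizes⇒⊆ κ cκ) (∇⊆α∨κ tt)

      all : ∀ p q → p Θ.~ q
      all = idempotent-class⇒∇ E (subalgebraOfSquare-⊨ β 𝒱 B⊨𝒱) syntactic (diagonal point)
        λ f → Θ.trans (Θ.reflexive (refl , refl)) (diagonal-collapses _ _)

    [α,β]≑Δ⇒β⊆κ : IsModular (Con B) → (α β κ : Congruence B) → Complemented (Con B) α →
      [ α , β ] ≑ Δ → α ∨ κ ≑ ∇ → β ⊆ κ
    [α,β]≑Δ⇒β⊆κ modular α β κ (α₁ , α∨α₁≑∇ , α∩α₁⊆Δ , _) ([α,β]⊆Δ , _) α∨κ≑∇ r =
      proj₁ (centralized⇒⊆ α κ β (κ ∩ β) α∨κ≑∇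
        -- Modularity with `κ ∩ β ⊆ β` rewrites `((κ ∩ β) ∨ α) ∩ β` as `(κ ∩ β) ∨ (α ∩ β)`, and
        -- `α ∩ β` is `Δ`.
        (centralizes-if α β (κ ∩ β) λ s →
          ∨-least (κ ∩ β) (α ∩ β) (κ ∩ β) id (λ u → Congruence.reflexive (κ ∩ β) (α∩β⊆Δ u))
            (proj₁ (modular (κ ∩ β) α β proj₂) s))
        (centralizes-if κ β (κ ∩ β) λ (s , q) → ∨-least (κ ∩ β) κ κ proj₁ id s , q)
        r)
      where
      α∩β⊆Δ : α ∩ β ⊆ Δ
      -- `α` centralizes `α ∩ β` since `[ α , β ]` is `Δ`; `α₁` does since it meets `α` in `Δ`.
      α∩β⊆Δ = centralized⇒⊆ α α₁ (α ∩ β) Δ α∨α₁≑∇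
        (λ t a a′ b b′ p q e → [α,β]⊆Δ (commutator-centralizes α β t a a′ b b′ p (proj₂ ∘ q) (eq e)))
        (centralizes-if α₁ (α ∩ β) Δ λ (s , u , _) →
          α∩α₁⊆Δ (u , ∨-least Δ α₁ α₁ (Congruence.reflexive α₁) id s))

-- Maximal congruences and the radical.

module _ {S : Signature} {ℓ : Level} (em : ExcludedMiddle (lsuc ℓ)) (zorn : ZornsLemma (lsuc ℓ) ℓ ℓ)
         (𝒱 : Variety S ℓ) (sd : Semidegenerate 𝒱) {B : Algebra S ℓ} (B⊨𝒱 : B ⊨ 𝒱) where
  open Algebra B using (Carrier; ⟦_⟧op; point)
  open Congruence using (_~_)

  module ProperAbove (ψ : Congruence B) (ψ≢∇ : ¬ (ψ ≑ ∇)) where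

    P : Poset (lsuc ℓ) ℓ ℓ
    P = record
      { Carrier        = Σ (Congruence B) λ φ → Lift (lsuc ℓ) ((ψ ⊆ φ) × ¬ (φ ≑ ∇))
      ; _≈_            = λ (φ , _) (φ′ , _) → φ ≑ φ′
      ; _≤_            = λ (φ , _) (φ′ , _) → φ ⊆ φ′
      ; isPartialOrder = record
        { isPreorder = record
          { isEquivalence = record
            { refl  = id , id
            ; sym   = λ (p , q) → q , p
            ; trans = λ (p , p′) (q , q′) → (λ r → q (p r)) , (λ r → p′ (q′ r))
            }
          ; reflexive = λ e → proj₁ e
          ; trans     = λ p q r → q (p r)
          }
        ; antisym = λ p q → p , q
        }
      }

    module P = Poset P

    ψ̂ : P.Carrier
    ψ̂ = ψ , lift (id , ψ≢∇)

    module _ (C : Pred P.Carrier (lsuc ℓ)) (chain : IsChain P C) where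

      -- Adjoining `ψ̂` makes the chain nonempty, so the union is a congruence above `ψ` even when
      -- `C` is empty.
      C₀ : Pred P.Carrier (lsuc ℓ)
      C₀ φ = (φ ≡ ψ̂) ⊎ C φ

      chain₀ : IsChain P C₀
      chain₀ φ φ′ (inj₁ ≡.refl) _             = inj₁ (proj₁ (lower (proj₂ φ′)))
      chain₀ φ φ′ (inj₂ _)      (inj₁ ≡.refl) = inj₂ (proj₁ (lower (proj₂ φ)))
      chain₀ φ φ′ (inj₂ p)      (inj₂ q)      = chain φ φ′ p q

      InUnion : Rel Carrier (lsuc ℓ)
      InUnion x y = ∃ λ φ → C₀ φ × _~_ (proj₁ φ) x y

      -- The union of C₀ is a relation one universe up; excluded middle brings it back down.
      Union : Rel Carrier ℓ
      Union x y = Lift ℓ (True (em {InUnion x y}))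

      into : ∀ {x y} → InUnion x y → Union x y
      into p = lift (fromWitness p)

      out : ∀ {x y} → Union x y → InUnion x y
      out (lift p) = toWitness p

      -- A chain is directed, so finitely many pairs of the union already lie in one member.
      common : ∀ n (xs ys : Fin n → Carrier) → (∀ i → Union (xs i) (ys i)) →
        ∃ λ φ → C₀ φ × (∀ i → _~_ (proj₁ φ) (xs i) (ys i))
      common zero    xs ys h = ψ̂ , inj₁ ≡.refl , λ ()
      common (suc n) xs ys h
        with out (h zero) | common n (xs ∘ suc) (ys ∘ suc) (h ∘ suc)
      ... | φ , c , r | φ′ , c′ , r′ with chain₀ φ φ′ c c′
      ... | inj₁ φ⊆φ′ = φ′ , c′ , λ { zero → φ⊆φ′ r ; (suc i) → r′ i }
      ... | inj₂ φ′⊆φ = φ , c , λ { zero → r ; (suc i) → φ′⊆φ (r′ i) }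

      union : Congruence B
      union = record
        { _~_           = Union
        ; isEquivalence = record
          { refl  = into (ψ̂ , inj₁ ≡.refl , Congruence.refl ψ)
          ; sym   = λ p → let φ , c , r = out p in into (φ , c , Congruence.sym (proj₁ φ) r)
          ; trans = λ {x} {y} {z} p q →
              let φ , c , r = common 2 (x ∷ y ∷ λ ()) (y ∷ z ∷ λ ())
                                (λ { zero → p ; (suc zero) → q })
              in into (φ , c , Congruence.trans (proj₁ φ) (r zero) (r (suc zero)))
          }
        ; reflexive     = λ e → into (ψ̂ , inj₁ ≡.refl , Congruence.reflexive ψ e)
        ; compatible    = λ f h →
            let φ , c , r = common _ _ _ h in into (φ , c , Congruence.compatible (proj₁ φ) f r)
        }

      union≢∇ : ¬ (union ≑ ∇)
      union≢∇ (_ , ∇⊆union) =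
        -- The signature is finite, so one member `φ` contains all pairs `(f(a,...,a) , a)` with `a`
        -- the base point; its class of `a` is then idempotent, forcing `φ` to be `∇`.
        let φ , _ , r = common _ (λ f → ⟦ f ⟧op (λ _ → point)) (λ _ → point) (λ _ → ∇⊆union tt)
        in proj₂ (lower (proj₂ φ))
             ((λ _ → tt) , λ {x} {y} _ → idempotent-class⇒∇ em 𝒱 sd B B⊨𝒱 (proj₁ φ) point r x y)

      upperBound : HasUpperBound P C
      upperBound = (union , lift ((λ r → into (ψ̂ , inj₁ ≡.refl , r)) , union≢∇)) ,
        λ φ c r → into (φ , inj₂ c , r)

    ⊆maximal : ∃ λ μ → Maximal μ × (ψ ⊆ μ)
    ⊆maximal with zorn P upperBound
    ... | (μ , lift (ψ⊆μ , μ≢∇)) , max =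
      μ , (μ≢∇ , λ φ μ⊆φ φ≢∇ → max (φ , lift ((λ r → μ⊆φ (ψ⊆μ r)) , φ≢∇)) μ⊆φ) , ψ⊆μ

  -- A proper `ψ` would lie below some maximal `μ`, which also contains `θ`, and then `ψ ∨ θ ⊆ μ`.
  ∨Rad-cancel : (θ : Congruence B) → (∀ {x y} → _~_ θ x y → Rad B x y) →
    (ψ : Congruence B) → ψ ∨ θ ≑ ∇ → ψ ≑ ∇
  ∨Rad-cancel θ θ⊆Rad ψ (_ , ∇⊆ψ∨θ) = stable em 𝒱 sd λ ψ≢∇ →
    let μ , (μ≢∇ , max) , ψ⊆μ = ProperAbove.⊆maximal ψ ψ≢∇
    in μ≢∇ ((λ _ → tt) , λ _ → ∨-least ψ θ μ ψ⊆μ (λ r → θ⊆Rad r μ (μ≢∇ , max)) (∇⊆ψ∨θ tt))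

-- Joins in the quotient by `θ`, and the transfer of B-normality.

module _ {S : Signature} {ℓ : Level} {A : Algebra S ℓ} (θ : Congruence A) where
  open Congruence using (_~_)

  pullback : Congruence (A / θ) → Congruence A
  pullback γ = record
    { _~_           = _~_ γ
    ; isEquivalence = Congruence.isEquivalence γ
    ; reflexive     = Congruence.reflexive γ ∘ Congruence.reflexive θ
    ; compatible    = Congruence.compatible γ
    }

  ∨/-∇⁺ : (χ ε : Congruence A) → χ ∨ ε ≑ ∇ → (χ ∨/ θ) ∨ (ε ∨/ θ) ≑ ∇
  ∨/-∇⁺ χ ε (_ , ∇⊆χ∨ε) = (λ _ → tt) , λ _ →
    ∨-least χ ε (pullback ((χ ∨/ θ) ∨ (ε ∨/ θ)))
      (λ r → base (inj₁ (base (inj₁ r)))) (λ r → base (inj₂ (base (inj₁ r)))) (∇⊆χ∨ε tt)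

  -- Brings an equation of `A / θ` back to `A` in the form from which `θ` can be cancelled; `γ` need
  -- only lie below the image of `α`.
  ∨/-∇⁻ : (χ α : Congruence A) (γ : Congruence (A / θ)) → γ ⊆ α ∨/ θ →
    (χ ∨/ θ) ∨ γ ≑ ∇ → (χ ∨ α) ∨ θ ≑ ∇
  ∨/-∇⁻ χ α γ γ⊆α (_ , ∇⊆χ∨γ) = (λ _ → tt) , λ _ →
    ∨-least (χ ∨/ θ) γ ((χ ∨ α) ∨/ θ)
      (∨-least χ θ ((χ ∨ α) ∨ θ) (λ r → base (inj₁ (base (inj₁ r)))) (λ r → base (inj₂ r)))
      (λ r → ∨-least α θ ((χ ∨ α) ∨ θ)
        (λ s → base (inj₁ (base (inj₂ s)))) (λ s → base (inj₂ s)) (γ⊆α r))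
      (∇⊆χ∨γ tt)

theorem6p10 : {ℓ : Level} →
    (em : ExcludedMiddle (lsuc ℓ)) → ZornsLemma (lsuc ℓ) ℓ ℓ →
    (S : Signature) (𝒱 : Variety S ℓ) →
    CongruenceModular 𝒱 →
    (sd : Semidegenerate 𝒱) →
    (K-closed : (B : Algebra S ℓ) → B ⊨ 𝒱 → CommutatorPreservesCompact B) →
    ((B : Algebra S ℓ) (B⊨𝒱 : B ⊨ 𝒱) →
    ReticulationPreservesBooleanCenter B (∇-compact em 𝒱 sd B⊨𝒱) (K-closed B B⊨𝒱)) →
    (A : Algebra S ℓ) → A ⊨ 𝒱 →
    (θ : Congruence A) →
    (∀ {x y} → Congruence._~_ θ x y → Rad A x y) →
    HasCBLP θ →
    IsBNormal (A / θ) →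
    IsBNormal A
theorem6p10 em zorn S 𝒱 modular sd _ _ A A⊨𝒱 θ θ⊆Rad cblp normal χ ε χ∨ε≑∇
  with normal (χ ∨/ θ) (ε ∨/ θ) (∨/-∇⁺ θ χ ε χ∨ε≑∇)
... | α′ , β′ , α′-compl , _ , χ∨α′≑∇ , ε∨β′≑∇ , [α′,β′]≑Δ
  with cblp α′ α′-compl
... | α , (α₁ , α∨α₁≑∇ , α∩α₁≑Δ) , α⊆α′ , α′⊆α =
    α , α₁ , (α₁ , α∨α₁≑∇ , α∩α₁≑Δ) , (α , complement-sym)
  , cancel (χ ∨ α) (∨/-∇⁻ θ χ α α′ α′⊆α χ∨α′≑∇)
  , cancel (ε ∨ α₁) (∨/-∇⁻ θ ε α₁ β′ β′⊆α₁ ε∨β′≑∇)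
  , (λ r → proj₁ α∩α₁≑Δ (commutator-⊆ˡ α α₁ r , commutator-⊆ʳ α α₁ r)) , eq
  where
  cancel : (ψ : Congruence A) → ψ ∨ θ ≑ ∇ → ψ ≑ ∇
  cancel = ∨Rad-cancel em zorn 𝒱 sd A⊨𝒱 θ θ⊆Rad

  complement-sym : (α₁ ∨ α ≑ ∇) × (α₁ ∩ α ≑ Δ)
  complement-sym =
    ((λ _ → tt) , λ _ → ∨-least α α₁ (α₁ ∨ α) (λ r → base (inj₂ r)) (λ r → base (inj₁ r))
                          (proj₂ α∨α₁≑∇ tt)) ,
    (λ (p , q) → proj₁ α∩α₁≑Δ (q , p)) , Congruence.reflexive (α₁ ∩ α)

  α′∨α₁≑∇ : α′ ∨ (α₁ ∨/ θ) ≑ ∇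
  α′∨α₁≑∇ = (λ _ → tt) , λ _ →
    -- The equation `α ∨ α₁ ≑ ∇` passes to the quotient, where the image of `α` lies in `α′`.
    ∨-least (α ∨/ θ) (α₁ ∨/ θ) (α′ ∨ (α₁ ∨/ θ)) (λ r → base (inj₁ (α⊆α′ r))) (λ r → base (inj₂ r))
      (proj₂ (∨/-∇⁺ θ α α₁ α∨α₁≑∇) tt)

  β′⊆α₁ : β′ ⊆ α₁ ∨/ θ
  β′⊆α₁ = [α,β]≑Δ⇒β⊆κ em 𝒱 sd A/θ⊨𝒱 (modular (A / θ) A/θ⊨𝒱) α′ β′ (α₁ ∨/ θ)
    α′-compl [α′,β′]≑Δ α′∨α₁≑∇
    where
    A/θ⊨𝒱 : A / θ ⊨ 𝒱
    A/θ⊨𝒱 = quotient-⊨ 𝒱 A⊨𝒱 θ
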